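{- Let $M_k$ denote a matching with $k$ edges. Then \[ \mathrm{ex}^*(n,M_k)=n(k-1)+O(k^2), \] where the implied constant is absolute, i.e. independent of $n$ and $k$.
   Context: For a fixed graph $F$, $\mathrm{ex}^*(n,F)$ (the rainbow Turán number of $F$) is the maximum number of edges in a graph on $n$ vertices that admits a proper edge-coloring containing no rainbow copy of $F$. A rainbow copy of $F$ is a copy of $F$ all of whose edges receive different colors. -}

module Defs where

open import Data.Nat using (ℕ; _<ᵇ_; _≤_)
open import Data.Bool using (Bool; true; false; _∧_)
open import Data.Fin using (Fin; toℕ)
open import Data.List using (List; length; filterᵇ; cartesianProduct; allFin)
open import Data.Product using (_×_; _,_; proj₁; proj₂; Σ; ∃)
open import Relation.Binary.PropositionalEquality using (_≡_; _≢_)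
open import Relation.Nullary using (¬_)

record Graph (n : ℕ) : Set where
  field
    adj   : Fin n → Fin n → Bool
    sym   : ∀ u v → adj u v ≡ adj v u
    irrefl : ∀ v → adj v v ≡ false
open Graph public

numEdges : ∀ {n} → Graph n → ℕ
numEdges {n} G =
  length (filterᵇ (λ p → (toℕ (proj₁ p) <ᵇ toℕ (proj₂ p)) ∧ adj G (proj₁ p) (proj₂ p))
                  (cartesianProduct (allFin n) (allFin n)))

record EdgeColouring {n : ℕ} (G : Graph n) : Set where
  field
    col    : Fin n → Fin n → ℕ
    colSym : ∀ u v → adj G u v ≡ true → col u v ≡ col v u
open EdgeColouring public

Proper : ∀ {n} {G : Graph n} → EdgeColouring G → Set
Proper {n} {G} c = ∀ (u v w : Fin n) → v ≢ w → adj G u v ≡ true → adj G u w ≡ true →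
                   col c u v ≢ col c u w

record RainbowMatching {n : ℕ} {G : Graph n} (c : EdgeColouring G) (k : ℕ) : Set where
  field
    edge     : Fin k → Fin n × Fin n
    isEdge   : ∀ i → adj G (proj₁ (edge i)) (proj₂ (edge i)) ≡ true
    disj₁₁   : ∀ i j → i ≢ j → proj₁ (edge i) ≢ proj₁ (edge j)
    disj₁₂   : ∀ i j → i ≢ j → proj₁ (edge i) ≢ proj₂ (edge j)
    disj₂₂   : ∀ i j → i ≢ j → proj₂ (edge i) ≢ proj₂ (edge j)
    rainbow  : ∀ i j → i ≢ j →
               col c (proj₁ (edge i)) (proj₂ (edge i)) ≢ col c (proj₁ (edge j)) (proj₂ (edge j))

Admissible : ∀ {n} → Graph n → ℕ → Set
Admissible G k = Σ (EdgeColouring G) λ c → Proper c × ¬ RainbowMatching c k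

IsRainbowTuranMatching : ℕ → ℕ → ℕ → Set
IsRainbowTuranMatching n k m =
  (Σ (Graph n) λ G → Admissible G k × numEdges G ≡ m) ×
  (∀ (G : Graph n) → Admissible G k → numEdges G ≤ m)

{-# OPTIONS --safe #-}
-- Lower bound: join j = k − 1 universal vertices to an independent set; every edge meets one of
-- the j vertices, so there is no k-matching at all.
-- Upper bound, by induction on j: a vertex of degree greater than 3j extends every rainbow
-- j-matching avoiding it, because such a matching blocks at most 3 of its neighbours through each
-- edge; deleting that vertex costs at most n edges and lowers j by one.  If all degrees are at most
-- 3j, take a maximal rainbow matching: every edge meets one of its at most 2j vertices, or shares
-- one of its at most j colours, and each colour class has at most n edges.  This gives nj + 6j².
-- The maximum itself is found by exhaustive search, as n² colours suffice.
module Submission where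

open import Defs renaming (sym to adj-sym)
open import Data.Bool using (Bool; true; false; _∧_; T?)
open import Data.Bool.Properties using (T-≡; T-∧) renaming (_≟_ to _≟ᵇ_)
open import Data.Fin using (Fin; zero; suc; toℕ; fromℕ<; combine; remQuot; finToFun; funToFin; _↑ˡ_; _↑ʳ_)
open import Data.Fin.Properties as Fin using (_≟_; any?; all?; injective⇒≤; finToFun-funToFin;
  remQuot-combine; toℕ-injective; toℕ<n; toℕ-↑ˡ; toℕ-↑ʳ; ↑ˡ-injective; ↑ʳ-injective)
open import Data.List using (List; []; _∷_; length; lookup; map; _++_; concatMap; filter; filterᵇ;
  allFin; cartesianProduct)
open import Data.List.Properties using (length-map; length-++; length-tabulate; length-filter)
open import Data.List.Membership.Propositional using (_∈_; lose)
open import Data.List.Membership.Propositional.Properties using (∈-lookup; ∈-filter⁺; ∈-filter⁻;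
  ∈-map⁺; ∈-map⁻; ∈-++⁺ˡ; ∈-++⁺ʳ; ∈-concatMap⁺; ∈-allFin; ∈-cartesianProduct⁺)
open import Data.List.Relation.Binary.Subset.Propositional using (_⊆_)
import Data.List.Relation.Unary.All as All
open import Data.List.Relation.Unary.Any using (here; there)
open import Data.List.Relation.Unary.Any.Properties using (lookup-index)
open import Data.List.Relation.Unary.AllPairs using (_∷_)
open import Data.List.Relation.Unary.Unique.Propositional using (Unique)
open import Data.List.Relation.Unary.Unique.Propositional.Properties using (allFin⁺; filter⁺; cartesianProduct⁺; map⁺)
open import Data.Nat using (ℕ; zero; suc; _+_; _*_; _∸_; _^_; _⊓_; _≤_; _<_; _<ᵇ_; z≤n)
open import Data.Nat.Properties as ℕ using (≤-trans; ≤-refl; ≤-reflexive)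
open import Data.Nat.Solver using (module +-*-Solver)
open import Data.Product using (_×_; _,_; proj₁; proj₂; Σ; ∃)
open import Data.Product.Properties using (,-injective)
open import Data.Sum using (_⊎_; inj₁; inj₂; swap)
open import Function using (_∘_; id; mk⇔; Equivalence)
open import Relation.Binary.PropositionalEquality using (_≡_; _≢_; refl; sym; trans; cong; cong₂; subst; subst₂; ≢-sym)
open import Relation.Nullary using (¬_; Dec; yes; no; does; contradiction; ¬?; _×-dec_; _⊎-dec_; _→-dec_)
open import Relation.Nullary.Decidable using (map′; decidable-stable; dec-true; dec-false; does-⇔)

private variable
  A B : Set
  n : ℕ

open Equivalence using (to; from)
open RainbowMatching

-- Counting with duplicate-free lists.

lookup-injective : {xs : List A} → Unique xs → ∀ {i j} → lookup xs i ≡ lookup xs j → i ≡ j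
lookup-injective (_ ∷ _)   {zero}  {zero}  _  = refl
lookup-injective (x∉ ∷ _)  {zero}  {suc j} eq = contradiction eq (All.lookup x∉ (∈-lookup j))
lookup-injective (x∉ ∷ _)  {suc i} {zero}  eq = contradiction (sym eq) (All.lookup x∉ (∈-lookup i))
lookup-injective (_ ∷ xs!) {suc i} {suc j} eq = cong suc (lookup-injective xs! eq)

-- Sending an index of `xs` to a position of the same element in `ys` is injective, as `lookup`
-- recovers the element. Repetitions in `ys` are allowed, so covers may overlap.
length-mono-⊆ : {xs ys : List A} → Unique xs → xs ⊆ ys → length xs ≤ length ys
length-mono-⊆ {xs = xs} {ys} xs! xs⊆ys = injective⇒≤ λ {i} {j} eq → lookup-injective xs!
  (trans (lookup-index (position i)) (trans (cong (lookup ys) eq) (sym (lookup-index (position j)))))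
  where
  position : ∀ i → lookup xs i ∈ ys
  position i = xs⊆ys (∈-lookup i)

length-concatMap-≤ : ∀ (f : A → List B) {b} → (∀ x → length (f x) ≤ b) →
                     ∀ xs → length (concatMap f xs) ≤ length xs * b
length-concatMap-≤ f f≤b []       = z≤n
length-concatMap-≤ f f≤b (x ∷ xs) = ≤-trans (≤-reflexive (length-++ (f x)))
  (ℕ.+-mono-≤ (f≤b x) (length-concatMap-≤ f f≤b xs))

length-cartesianProduct : ∀ (xs : List A) (ys : List B) →
                          length (cartesianProduct xs ys) ≡ length xs * length ys
length-cartesianProduct []       ys = refl
length-cartesianProduct (x ∷ xs) ys = trans (length-++ (map (x ,_) ys))
  (cong₂ _+_ (length-map (x ,_) ys) (length-cartesianProduct xs ys))

length-allFin : ∀ n → length (allFin n) ≡ n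
length-allFin n = length-tabulate id

-- Downward search from the bound; at bound 0 the witness itself is the maximum.
maximum : ∀ {P : ℕ → Set} → (∀ m → Dec (P m)) → ∀ b → (∀ m → P m → m ≤ b) → ∃ P →
          ∃ λ m → P m × (∀ m′ → P m′ → m′ ≤ m)
maximum P? zero    P≤b (m , pm) = m , pm , λ m′ pm′ → ≤-trans (P≤b m′ pm′) z≤n
maximum P? (suc b) P≤b ∃P with P? (suc b)
... | yes p = suc b , p , P≤b
... | no ¬p = maximum P? b (λ m pm → ℕ.≤-pred (ℕ.≤∧≢⇒< (P≤b m pm) λ { refl → ¬p pm })) ∃P

-- Simple graphs: edge lists, neighbourhoods and stars.

does⁻ : (a? : Dec A) → does a? ≡ true → A
does⁻ (yes a) _ = a

graphOf : {R : Fin n → Fin n → Set} → (∀ u v → Dec (R u v)) →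
          (∀ {u v} → R u v → R v u) → (∀ {v} → ¬ R v v) → Graph n
graphOf R? R-sym R-irrefl = record
  { adj    = λ u v → does (R? u v)
  ; sym    = λ u v → does-⇔ (mk⇔ R-sym R-sym) (R? u v) (R? v u)
  ; irrefl = λ v → dec-false (R? v v) R-irrefl
  }

Adj : Graph n → Fin n → Fin n → Set
Adj G u v = adj G u v ≡ true

module _ {n : ℕ} (G : Graph n) where

  Adj-sym : ∀ {u v} → Adj G u v → Adj G v u
  Adj-sym {u} {v} uv = trans (adj-sym G v u) uv

  Adj-irrefl : ∀ {u v} → Adj G u v → u ≢ v
  Adj-irrefl {u} uu refl = contradiction (trans (sym uu) (irrefl G u)) λ ()

  ascendingEdge : Fin n × Fin n → Bool
  ascendingEdge (u , v) = (toℕ u <ᵇ toℕ v) ∧ adj G u v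

  pairs : List (Fin n × Fin n)
  pairs = cartesianProduct (allFin n) (allFin n)

  -- `length edges` unfolds to `numEdges G`, so list inclusions bound edge counts directly.
  edges : List (Fin n × Fin n)
  edges = filterᵇ ascendingEdge pairs

  edges-unique : Unique edges
  edges-unique = filter⁺ _ (cartesianProduct⁺ (allFin⁺ n) (allFin⁺ n))

  ∈-edges⁺ : ∀ {u v} → toℕ u < toℕ v → Adj G u v → (u , v) ∈ edges
  ∈-edges⁺ u<v uv = ∈-filter⁺ _ (∈-cartesianProduct⁺ (∈-allFin _) (∈-allFin _))
    (from T-∧ (ℕ.<⇒<ᵇ u<v , from T-≡ uv))

  ∈-edges⁻ : ∀ {u v} → (u , v) ∈ edges → toℕ u < toℕ v × Adj G u v
  ∈-edges⁻ {u} {v} e∈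
    with u<v , uv ← to (T-∧ {toℕ u <ᵇ toℕ v}) (proj₂ (∈-filter⁻ (T? ∘ ascendingEdge) {xs = pairs} e∈))
    = ℕ.<ᵇ⇒< _ _ u<v , to T-≡ uv

  neighbours : Fin n → List (Fin n)
  neighbours v = filter (λ u → adj G v u ≟ᵇ true) (allFin n)

  degree : Fin n → ℕ
  degree v = length (neighbours v)

  neighbours-unique : ∀ v → Unique (neighbours v)
  neighbours-unique v = filter⁺ _ (allFin⁺ n)

  ∈-neighbours⁺ : ∀ {v u} → Adj G v u → u ∈ neighbours v
  ∈-neighbours⁺ vu = ∈-filter⁺ _ (∈-allFin _) vu

  ∈-neighbours⁻ : ∀ {v u} → u ∈ neighbours v → Adj G v u
  ∈-neighbours⁻ {v} u∈ = proj₂ (∈-filter⁻ (λ u → adj G v u ≟ᵇ true) {xs = allFin n} u∈)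

  degree≤n : ∀ v → degree v ≤ n
  degree≤n v = ≤-trans (length-filter _ (allFin n)) (≤-reflexive (length-allFin n))

numEdges-mono : (G H : Graph n) → (∀ {u v} → Adj G u v → Adj H u v) → numEdges G ≤ numEdges H
numEdges-mono G H G⊆H = length-mono-⊆ (edges-unique G) λ e∈ →
  let u<v , uv = ∈-edges⁻ G e∈ in ∈-edges⁺ H u<v (G⊆H uv)

-- The list `edges` stores the smaller endpoint first, so the edges at a vertex must be put in this
-- order.
orient : Fin n → Fin n → Fin n × Fin n
orient w x with toℕ w ℕ.<? toℕ x
... | yes _ = w , x
... | no  _ = x , w

orient-< : {w x : Fin n} → toℕ w < toℕ x → orient w x ≡ (w , x)
orient-< {w = w} {x} w<x with toℕ w ℕ.<? toℕ x
... | yes _   = refl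
... | no  w≮x = contradiction w<x w≮x

orient-> : {w x : Fin n} → toℕ x < toℕ w → orient w x ≡ (x , w)
orient-> {w = w} {x} x<w with toℕ w ℕ.<? toℕ x
... | yes w<x = contradiction w<x (ℕ.<-asym x<w)
... | no  _   = refl

Endpoint : Fin n → Fin n × Fin n → Set
Endpoint w e = w ≡ proj₁ e ⊎ w ≡ proj₂ e

endpoint? : ∀ (w : Fin n) e → Dec (Endpoint w e)
endpoint? w e = (w ≟ proj₁ e) ⊎-dec (w ≟ proj₂ e)

starAt : Graph n → Fin n → List (Fin n × Fin n)
starAt G w = map (orient w) (neighbours G w)

length-starAt : ∀ (G : Graph n) w → length (starAt G w) ≡ degree G w
length-starAt G w = length-map (orient w) (neighbours G w)

∈-starAt : ∀ (G : Graph n) {w e} → e ∈ edges G → Endpoint w e → e ∈ starAt G w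
∈-starAt G {w} e∈ (inj₁ refl) with u<v , uv ← ∈-edges⁻ G e∈ =
  subst (_∈ starAt G w) (orient-< u<v) (∈-map⁺ (orient w) (∈-neighbours⁺ G uv))
∈-starAt G {w} e∈ (inj₂ refl) with u<v , uv ← ∈-edges⁻ G e∈ =
  subst (_∈ starAt G w) (orient-> u<v) (∈-map⁺ (orient w) (∈-neighbours⁺ G (Adj-sym G uv)))

-- Rainbow matchings in a fixed colouring.

module _ {n : ℕ} {G : Graph n} (c : EdgeColouring G) where

  colourOf : Fin n × Fin n → ℕ
  colourOf e = col c (proj₁ e) (proj₂ e)

  -- The other end of the γ-coloured edge at u, with junk value u if there is none.
  partner : ℕ → Fin n → Fin n
  partner γ u with any? (λ v → (adj G u v ≟ᵇ true) ×-dec (col c u v ℕ.≟ γ))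
  ... | yes (v , _) = v
  ... | no  _       = u

  -- Properness allows at most one edge of colour `γ` at `u`, so whichever vertex the search finds
  -- is the only one.
  partner-unique : Proper c → ∀ {γ u v} → Adj G u v → col c u v ≡ γ → v ≡ partner γ u
  partner-unique proper {γ} {u} {v} uv uv-γ
    with any? (λ v → (adj G u v ≟ᵇ true) ×-dec (col c u v ℕ.≟ γ))
  ... | yes (w , uw , uw-γ) = decidable-stable (v ≟ w) λ v≢w →
          proper u v w v≢w uv uw (trans uv-γ (sym uw-γ))
  ... | no ∄v = contradiction (v , uv , uv-γ) ∄v

  proper? : Dec (Proper c)
  proper? = all? λ u → all? λ v → all? λ w →
    ¬? (v ≟ w) →-dec ((adj G u v ≟ᵇ true) →-dec ((adj G u w ≟ᵇ true) →-dec ¬? (col c u v ℕ.≟ col c u w)))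

  edges→rainbow : ∀ {k} (e : Fin k → Fin n × Fin n) →
    (∀ i → Adj G (proj₁ (e i)) (proj₂ (e i))) →
    (∀ i j → i ≢ j → proj₁ (e i) ≢ proj₁ (e j) × proj₁ (e i) ≢ proj₂ (e j) ×
                     proj₂ (e i) ≢ proj₂ (e j) × colourOf (e i) ≢ colourOf (e j)) →
    RainbowMatching c k
  edges→rainbow e e-adj e-apart = record
    { edge    = e
    ; isEdge  = e-adj
    ; disj₁₁  = λ i j i≢j → proj₁ (e-apart i j i≢j)
    ; disj₁₂  = λ i j i≢j → proj₁ (proj₂ (e-apart i j i≢j))
    ; disj₂₂  = λ i j i≢j → proj₁ (proj₂ (proj₂ (e-apart i j i≢j)))
    ; rainbow = λ i j i≢j → proj₂ (proj₂ (proj₂ (e-apart i j i≢j)))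
    }

  -- `any?` searches a `Fin`, so a family of `k` vertex pairs is encoded as a number below
  -- `(n * n) ^ k`.
  rainbow? : ∀ k → Dec (RainbowMatching c k)
  rainbow? k = map′
    (λ { (_ , e-adj , e-apart) → edges→rainbow _ e-adj e-apart })
    (λ M → funToFin (λ i → combine (proj₁ (edge M i)) (proj₂ (edge M i)))
         , (λ i → subst (λ p → Adj G (proj₁ p) (proj₂ p)) (sym (decode-encode M i)) (isEdge M i))
         , (λ i j i≢j → subst₂ Apart (sym (decode-encode M i)) (sym (decode-encode M j))
             (disj₁₁ M i j i≢j , disj₁₂ M i j i≢j , disj₂₂ M i j i≢j , rainbow M i j i≢j)))
    (any? λ x → all? (λ i → adj G _ _ ≟ᵇ true) ×-dec
                all? (λ i → all? λ j → ¬? (i ≟ j) →-dec apart? (decode x i) (decode x j)))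
    where
    Apart : Fin n × Fin n → Fin n × Fin n → Set
    Apart e f = proj₁ e ≢ proj₁ f × proj₁ e ≢ proj₂ f × proj₂ e ≢ proj₂ f × colourOf e ≢ colourOf f

    apart? : ∀ e f → Dec (Apart e f)
    apart? e f = ¬? (proj₁ e ≟ proj₁ f) ×-dec ¬? (proj₁ e ≟ proj₂ f) ×-dec
                 ¬? (proj₂ e ≟ proj₂ f) ×-dec ¬? (colourOf e ℕ.≟ colourOf f)

    decode : Fin ((n * n) ^ k) → Fin k → Fin n × Fin n
    decode x i = remQuot n (finToFun x i)

    decode-encode : ∀ (M : RainbowMatching c k) i →
      decode (funToFin (λ i → combine (proj₁ (edge M i)) (proj₂ (edge M i)))) i ≡ edge M i
    decode-encode M i = trans (cong (remQuot n) (finToFun-funToFin _ i)) (remQuot-combine _ _)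

  -- The ways in which the matching edge with index `i` prevents adding the edge from `x` to `y`.
  Conflict : ∀ {k} → RainbowMatching c k → Fin n → Fin n → Fin k → Set
  Conflict M x y i = Endpoint x (edge M i) ⊎ Endpoint y (edge M i) ⊎ col c x y ≡ colourOf (edge M i)

  extend : ∀ {k x y} (M : RainbowMatching c k) → Adj G x y → (∀ i → ¬ Conflict M x y i) →
           RainbowMatching c (suc k)
  extend {k} {x} {y} M xy free = edges→rainbow e′
    (λ { zero → xy ; (suc i) → isEdge M i })
    λ { zero    zero    0≢0 → contradiction refl 0≢0
      ; zero    (suc i) _   → free i ∘ inj₁ ∘ inj₁ , free i ∘ inj₁ ∘ inj₂
                            , free i ∘ inj₂ ∘ inj₁ ∘ inj₂ , free i ∘ inj₂ ∘ inj₂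
      ; (suc i) zero    _   → free i ∘ inj₁ ∘ inj₁ ∘ sym , free i ∘ inj₂ ∘ inj₁ ∘ inj₁ ∘ sym
                            , free i ∘ inj₂ ∘ inj₁ ∘ inj₂ ∘ sym , free i ∘ inj₂ ∘ inj₂ ∘ sym
      ; (suc i) (suc j) i≢j → let i≢j = i≢j ∘ cong suc in
          disj₁₁ M i j i≢j , disj₁₂ M i j i≢j , disj₂₂ M i j i≢j , rainbow M i j i≢j }
    where
    e′ : Fin (suc k) → Fin n × Fin n
    e′ zero    = x , y
    e′ (suc i) = edge M i

  conflicting : ∀ {k x y} (M : RainbowMatching c k) → ¬ RainbowMatching c (suc k) → Adj G x y →
                ∃ (Conflict M x y)
  conflicting {x = x} {y} M maximal xy
    with any? (λ i → endpoint? x (edge M i) ⊎-dec endpoint? y (edge M i) ⊎-dec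
                     (col c x y ℕ.≟ colourOf (edge M i)))
  ... | yes conflict = conflict
  ... | no ∄conflict = contradiction (extend M xy λ i cf → ∄conflict (i , cf)) maximal

  -- Decidability allows a descent from `j` to the first size that occurs; the empty matching stops
  -- it at 0.
  maximalMatching : ∀ j → ¬ RainbowMatching c (suc j) →
                    ∃ λ t → t ≤ j × RainbowMatching c t × ¬ RainbowMatching c (suc t)
  maximalMatching zero    ¬M = zero , z≤n , edges→rainbow (λ ()) (λ ()) (λ ()) , ¬M
  maximalMatching (suc j) ¬M with rainbow? (suc j)
  ... | yes M  = suc j , ≤-refl , M , ¬M
  ... | no ¬M′ with t , t≤j , Mₜ ← maximalMatching j ¬M′ = t , ℕ.m≤n⇒m≤1+n t≤j , Mₜ

  -- One pair per vertex, hence length `n`. For a proper colouring this contains every edge of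
  -- colour `γ`; a vertex without such an edge contributes a junk pair.
  colourClass : ℕ → List (Fin n × Fin n)
  colourClass γ = map (λ u → u , partner γ u) (allFin n)

  -- Each of the `t` matching edges blocks two stars of at most `d` edges and one colour class of at
  -- most `n`.
  maximal-bound : Proper c → ∀ {t d} → RainbowMatching c t → ¬ RainbowMatching c (suc t) →
                  (∀ v → degree G v ≤ d) → numEdges G ≤ t * (d + (d + n))
  maximal-bound proper {t} {d} M maximal deg≤d = ≤-trans
    (length-mono-⊆ (edges-unique G) covered)
    (subst (λ s → length (concatMap cover (allFin t)) ≤ s * (d + (d + n))) (length-allFin t)
      (length-concatMap-≤ cover cover-length (allFin t)))
    where
    cover : Fin t → List (Fin n × Fin n)
    cover i = starAt G (proj₁ (edge M i)) ++ starAt G (proj₂ (edge M i)) ++ colourClass (colourOf (edge M i))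

    star≤d : ∀ w → length (starAt G w) ≤ d
    star≤d w = ≤-trans (≤-reflexive (length-starAt G w)) (deg≤d w)

    cover-length : ∀ i → length (cover i) ≤ d + (d + n)
    cover-length i = ≤-trans (≤-reflexive (length-++ (starAt G _)))
      (ℕ.+-mono-≤ (star≤d _) (≤-trans (≤-reflexive (length-++ (starAt G _)))
        (ℕ.+-mono-≤ (star≤d _) (≤-reflexive (trans (length-map _ (allFin n)) (length-allFin n))))))

    ∈-stars : ∀ i {e w} → e ∈ edges G → Endpoint w e → Endpoint w (edge M i) → e ∈ cover i
    ∈-stars i e∈ w∈e (inj₁ refl) = ∈-++⁺ˡ (∈-starAt G e∈ w∈e)
    ∈-stars i e∈ w∈e (inj₂ refl) = ∈-++⁺ʳ (starAt G _) (∈-++⁺ˡ (∈-starAt G e∈ w∈e))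

    ∈-cover : ∀ i {u v} → (u , v) ∈ edges G → Conflict M u v i → (u , v) ∈ cover i
    ∈-cover i e∈ (inj₁ u∈)              = ∈-stars i e∈ (inj₁ refl) u∈
    ∈-cover i e∈ (inj₂ (inj₁ v∈))       = ∈-stars i e∈ (inj₂ refl) v∈
    ∈-cover i {u} {v} e∈ (inj₂ (inj₂ same)) = ∈-++⁺ʳ (starAt G _) (∈-++⁺ʳ (starAt G _)
      (subst (λ w → (u , w) ∈ colourClass _) (sym (partner-unique proper (proj₂ (∈-edges⁻ G e∈)) same))
        (∈-map⁺ _ (∈-allFin u))))

    covered : edges G ⊆ concatMap cover (allFin t)
    covered e∈ with i , conflict ← conflicting M maximal (proj₂ (∈-edges⁻ G e∈)) =
      ∈-concatMap⁺ cover (lose (∈-allFin i) (∈-cover i e∈ conflict))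

  -- With `v` off the matching, a matching edge blocks at most three neighbours of `v`: its two
  -- endpoints and the one vertex joined to `v` in its colour.
  degree-bound : Proper c → ∀ {t} v (M : RainbowMatching c t) → ¬ RainbowMatching c (suc t) →
                 (∀ i → ¬ Endpoint v (edge M i)) → degree G v ≤ t * 3
  degree-bound proper {t} v M maximal avoids = ≤-trans
    (length-mono-⊆ (neighbours-unique G v) covered)
    (subst (λ s → length (concatMap cover (allFin t)) ≤ s * 3) (length-allFin t)
      (length-concatMap-≤ cover (λ _ → ≤-refl) (allFin t)))
    where
    cover : Fin t → List (Fin n)
    cover i = proj₁ (edge M i) ∷ proj₂ (edge M i) ∷ partner (colourOf (edge M i)) v ∷ []

    ∈-cover : ∀ i {x} → Adj G v x → Conflict M v x i → x ∈ cover i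
    ∈-cover i vx (inj₁ v∈)                 = contradiction v∈ (avoids i)
    ∈-cover i vx (inj₂ (inj₁ (inj₁ x≡)))   = here x≡
    ∈-cover i vx (inj₂ (inj₁ (inj₂ x≡)))   = there (here x≡)
    ∈-cover i vx (inj₂ (inj₂ same))        = there (there (here (partner-unique proper vx same)))

    covered : neighbours G v ⊆ concatMap cover (allFin t)
    covered x∈ with vx ← ∈-neighbours⁻ G x∈ with i , conflict ← conflicting M maximal vx =
      ∈-concatMap⁺ cover (lose (∈-allFin i) (∈-cover i vx conflict))

-- Rainbowness asserts inequalities, so the condition on colours runs against the direction of
-- transfer: a coincidence under `c` must give one under `d`.
rainbow-map : ∀ {G H : Graph n} {k} (c : EdgeColouring G) (d : EdgeColouring H) →
  (∀ {u v} → Adj H u v → Adj G u v) →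
  (∀ {u v w x} → Adj G u v → Adj G w x → col c u v ≡ col c w x → col d u v ≡ col d w x) →
  RainbowMatching d k → RainbowMatching c k
rainbow-map c d H⊆G c⇒d M = edges→rainbow c (edge M) (H⊆G ∘ isEdge M) λ i j i≢j →
  disj₁₁ M i j i≢j , disj₁₂ M i j i≢j , disj₂₂ M i j i≢j ,
  rainbow M i j i≢j ∘ c⇒d (H⊆G (isEdge M i)) (H⊆G (isEdge M j))

-- Deletion of a vertex.

module _ (G : Graph n) (v : Fin n) where

  kept? : ∀ x y → Dec (Adj G x y × x ≢ v × y ≢ v)
  kept? x y = (adj G x y ≟ᵇ true) ×-dec ¬? (x ≟ v) ×-dec ¬? (y ≟ v)

  -- v stays as an isolated vertex, so that the vertex type does not change.
  isolate : Graph n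
  isolate = graphOf kept? (λ (xy , x≢v , y≢v) → Adj-sym G xy , y≢v , x≢v)
                          (λ (xx , _) → Adj-irrefl G xx refl)

  isolate⁻ : ∀ {x y} → Adj isolate x y → Adj G x y × x ≢ v × y ≢ v
  isolate⁻ {x} {y} = does⁻ (kept? x y)

  numEdges-isolate : numEdges G ≤ n + numEdges isolate
  numEdges-isolate = ≤-trans (length-mono-⊆ (edges-unique G) covered)
    (≤-trans (≤-reflexive (length-++ (starAt G v)))
      (ℕ.+-monoˡ-≤ _ (≤-trans (≤-reflexive (length-starAt G v)) (degree≤n G v))))
    where
    covered : edges G ⊆ starAt G v ++ edges isolate
    covered {x , y} e∈ with endpoint? v (x , y)
    ... | yes v∈e = ∈-++⁺ˡ (∈-starAt G e∈ v∈e)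
    ... | no  v∉e with x<y , xy ← ∈-edges⁻ G e∈ = ∈-++⁺ʳ (starAt G v) (∈-edges⁺ isolate x<y
      (dec-true (kept? x y) (xy , (λ { refl → v∉e (inj₁ refl) }) , λ { refl → v∉e (inj₂ refl) })))

  isolateColouring : EdgeColouring G → EdgeColouring isolate
  isolateColouring c = record { col = col c ; colSym = λ x y xy → colSym c x y (proj₁ (isolate⁻ xy)) }

  isolate-proper : ∀ c → Proper c → Proper (isolateColouring c)
  isolate-proper c proper x y z y≢z xy xz = proper x y z y≢z (proj₁ (isolate⁻ xy)) (proj₁ (isolate⁻ xz))

  isolate-rainbow : ∀ c {k} → RainbowMatching (isolateColouring c) k → RainbowMatching c k
  isolate-rainbow c = rainbow-map c (isolateColouring c) (proj₁ ∘ isolate⁻) (λ _ _ → id)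

  -- A `k`-matching of the remaining graph avoids `v` and, seen in `G`, cannot be extended, so
  -- `degree-bound` contradicts the large degree.
  isolate-¬rainbow : ∀ c → Proper c → ∀ {k} → k * 3 < degree G v → ¬ RainbowMatching c (suc k) →
                     ¬ RainbowMatching (isolateColouring c) k
  isolate-¬rainbow c proper large maximal M = ℕ.<⇒≱ large
    (degree-bound c proper v (isolate-rainbow c M) maximal λ
      { i (inj₁ v≡) → proj₁ (proj₂ (isolate⁻ (isEdge M i))) (sym v≡)
      ; i (inj₂ v≡) → proj₂ (proj₂ (isolate⁻ (isEdge M i))) (sym v≡) })

-- The upper bound on the number of edges.

numEdges-≤ : ∀ j (G : Graph n) (c : EdgeColouring G) → Proper c → ¬ RainbowMatching c (suc j) →
             numEdges G ≤ n * j + 6 * (j * j)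
-- The maximal matching is empty here, so the estimate is 0 whatever the degree bound.
numEdges-≤ zero G c proper ¬M with zero , z≤n , M , maximal ← maximalMatching c 0 ¬M =
  ≤-trans (maximal-bound c proper M maximal (degree≤n G)) z≤n
-- The threshold serves both cases: above it, deletion leaves no rainbow matching of size `suc j`;
-- otherwise it is the degree bound `d`.
numEdges-≤ {n} (suc j) G c proper ¬M with any? (λ v → suc j * 3 ℕ.<? degree G v)
... | yes (v , large) = begin
  numEdges G                                ≤⟨ numEdges-isolate G v ⟩
  n + numEdges (isolate G v)                ≤⟨ ℕ.+-monoʳ-≤ n (numEdges-≤ j (isolate G v)
                                                 (isolateColouring G v c) (isolate-proper G v c proper)
                                                 (isolate-¬rainbow G v c proper large ¬M)) ⟩
  n + (n * j + 6 * (j * j))                 ≡⟨ solve 2 (λ n j → n :+ (n :* j :+ con 6 :* (j :* j))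
                                                 := n :* (con 1 :+ j) :+ con 6 :* (j :* j)) refl n j ⟩
  n * suc j + 6 * (j * j)                   ≤⟨ ℕ.+-monoʳ-≤ (n * suc j) (ℕ.*-monoʳ-≤ 6
                                                 (ℕ.*-mono-≤ (ℕ.n≤1+n j) (ℕ.n≤1+n j))) ⟩
  n * suc j + 6 * (suc j * suc j)           ∎
  where open ℕ.≤-Reasoning ; open +-*-Solver
... | no small with t , t≤j , M , maximal ← maximalMatching c (suc j) ¬M = begin
  numEdges G                                ≤⟨ maximal-bound c proper M maximal
                                                 (λ v → ℕ.≮⇒≥ λ large → small (v , large)) ⟩
  t * (s * 3 + (s * 3 + n))                 ≤⟨ ℕ.*-monoˡ-≤ _ t≤j ⟩
  -- Two stars of size `s * 3` for each of `s` edges give the quadratic term; the colour classes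
  -- give `n * s`.
  s * (s * 3 + (s * 3 + n))                 ≡⟨ solve 2 (λ s n → s :* (s :* con 3 :+ (s :* con 3 :+ n))
                                                 := n :* s :+ con 6 :* (s :* s)) refl s n ⟩
  n * s + 6 * (s * s)                       ∎
  where
  open ℕ.≤-Reasoning
  open +-*-Solver
  s = suc j

-- Finite search over coloured graphs.

-- A table of labels for the ordered pairs, written as one number so that it can be searched. There
-- are `n * n` labels for colours and one for non-edges.
record Code (n : ℕ) : Set where
  constructor code
  field number : Fin (suc (n * n) ^ (n * n))

  read : Fin n → Fin n → Fin (suc (n * n))
  read u v = finToFun number (combine u v)

open Code using (read)

-- The label 0 marks a non-edge and a positive label is the colour of an edge; taking the minimum of
-- both orientations makes every code decode to a symmetric labelling.
label : Code n → Fin n → Fin n → ℕ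
label x u v = toℕ (read x u v) ⊓ toℕ (read x v u)

label-sym : ∀ (x : Code n) u v → label x u v ≡ label x v u
label-sym x u v = ℕ.⊓-comm (toℕ (read x u v)) _

labelled? : ∀ (x : Code n) u v → Dec (u ≢ v × label x u v ≢ 0)
labelled? x u v = ¬? (u ≟ v) ×-dec ¬? (label x u v ℕ.≟ 0)

decodeGraph : Code n → Graph n
decodeGraph x = graphOf (labelled? x)
  (λ {u} {v} (u≢v , l≢0) → ≢-sym u≢v , l≢0 ∘ trans (label-sym x u v))
  (λ (v≢v , _) → v≢v refl)

decodeColouring : (x : Code n) → EdgeColouring (decodeGraph x)
decodeColouring x = record { col = label x ; colSym = λ u v _ → label-sym x u v }

module _ {n : ℕ} {G : Graph n} (c : EdgeColouring G) where

  HasColour : ℕ → Fin (n * n) → Set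
  HasColour γ p = colourOf c (remQuot n p) ≡ γ

  hasColour? : ∀ γ p → Dec (HasColour γ p)
  hasColour? γ p = colourOf c (remQuot n p) ℕ.≟ γ

  -- The new name of a colour is the position of a pair carrying it, shifted by one to keep `zero`
  -- for non-edges. The choice depends on `γ` alone, so equal colours stay equal.
  recolour : ℕ → Fin (suc (n * n))
  recolour γ with any? (hasColour? γ)
  ... | yes (p , _) = suc p
  ... | no  _       = zero

  recolour-suc : ∀ u v → ∃ λ p → recolour (col c u v) ≡ suc p × HasColour (col c u v) p
  recolour-suc u v with any? (hasColour? (col c u v))
  ... | yes (p , p-γ) = p , refl , p-γ
  ... | no  ∄p        = contradiction (combine u v , cong (colourOf c) (remQuot-combine u v)) ∄p

  recolour-injective : ∀ u v w x → recolour (col c u v) ≡ recolour (col c w x) → col c u v ≡ col c w x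
  recolour-injective u v w x eq
    with p , uv-p , p-uv ← recolour-suc u v with q , wx-q , q-wx ← recolour-suc w x
    with refl ← trans (sym uv-p) (trans eq wx-q) = trans (sym p-uv) q-wx

  -- Non-edges are blanked because `col` is arbitrary there, possibly not symmetric.
  paint : Fin n × Fin n → Fin (suc (n * n))
  paint (u , v) with adj G u v
  ... | true  = recolour (col c u v)
  ... | false = zero

  paint-edge : ∀ {u v} → Adj G u v → paint (u , v) ≡ recolour (col c u v)
  paint-edge uv rewrite uv = refl

  paint≢zero⇒edge : ∀ {u v} → paint (u , v) ≢ zero → Adj G u v
  paint≢zero⇒edge {u} {v} p≢0 with adj G u v
  ... | true  = refl
  ... | false = contradiction refl p≢0

  paint-sym : ∀ u v → paint (u , v) ≡ paint (v , u)
  paint-sym u v with adj G u v in uv | adj G v u in vu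
  ... | true  | true  = cong recolour (colSym c u v uv)
  ... | true  | false = contradiction (trans (sym (Adj-sym G uv)) vu) λ ()
  ... | false | true  = contradiction (trans (sym (Adj-sym G vu)) uv) λ ()
  ... | false | false = refl

  encode : Code n
  encode = code (funToFin (paint ∘ remQuot n))

  -- `paint` is symmetric, so `label` takes the minimum of two equal values.
  label-encode : ∀ u v → label encode u v ≡ toℕ (paint (u , v))
  label-encode u v = trans
    (cong₂ _⊓_ (cong toℕ (read-encode u v)) (cong toℕ (trans (read-encode v u) (paint-sym v u)))) (ℕ.⊓-idem _)
    where
    read-encode : ∀ u v → read encode u v ≡ paint (u , v)
    read-encode u v = trans (finToFun-funToFin (paint ∘ remQuot n) (combine u v)) (cong paint (remQuot-combine u v))

  label-edge : ∀ {u v} → Adj G u v → label encode u v ≡ toℕ (recolour (col c u v))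
  label-edge uv = trans (label-encode _ _) (cong toℕ (paint-edge uv))

  encode⁺ : ∀ {u v} → Adj G u v → Adj (decodeGraph encode) u v
  encode⁺ {u} {v} uv with p , uv-p , _ ← recolour-suc u v = dec-true (labelled? encode u v)
    (Adj-irrefl G uv , λ l≡0 → contradiction (trans (sym (trans (label-edge uv) (cong toℕ uv-p))) l≡0) λ ())

  encode⁻ : ∀ {u v} → Adj (decodeGraph encode) u v → Adj G u v
  encode⁻ {u} {v} uv = paint≢zero⇒edge λ p≡0 →
    proj₂ (does⁻ (labelled? encode u v) uv) (trans (label-encode u v) (cong toℕ p≡0))

  -- Injectivity of `recolour` carries a clash of new colours back to a clash of old ones.
  encode-proper : Proper c → Proper (decodeColouring encode)
  encode-proper proper u v w v≢w uv uw eq = proper u v w v≢w (encode⁻ uv) (encode⁻ uw)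
    (recolour-injective u v u w (toℕ-injective
      (trans (sym (label-edge (encode⁻ uv))) (trans eq (label-edge (encode⁻ uw))))))

  encode-rainbow : ∀ {k} → RainbowMatching (decodeColouring encode) k → RainbowMatching c k
  encode-rainbow = rainbow-map c (decodeColouring encode) encode⁻ λ uv wx eq →
    trans (label-edge uv) (trans (cong (toℕ ∘ recolour) eq) (sym (label-edge wx)))

  numEdges-encode : numEdges (decodeGraph encode) ≡ numEdges G
  numEdges-encode = ℕ.≤-antisym (numEdges-mono (decodeGraph encode) G encode⁻)
                                (numEdges-mono G (decodeGraph encode) encode⁺)

Attained : ℕ → ℕ → ℕ → Set
Attained n k m = Σ (Graph n) λ G → Admissible G k × numEdges G ≡ m

-- Every admissible coloured graph has a code with the same edge count, so searching the codes
-- misses no value.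
attained? : ∀ n k m → Dec (Attained n k m)
attained? n k m = map′
  (λ (x , (proper , ¬M) , eq) → decodeGraph (code x) , (decodeColouring (code x) , proper , ¬M) , eq)
  (λ (G , (c , proper , ¬M) , eq) →
    Code.number (encode c) , (encode-proper c proper , ¬M ∘ encode-rainbow c) , trans (numEdges-encode c) eq)
  (any? λ x → (proper? (decodeColouring (code x)) ×-dec ¬? (rainbow? (decodeColouring (code x)) k))
              ×-dec (numEdges (decodeGraph (code {n} x)) ℕ.≟ m))

attained-≤ : ∀ {n j} m → Attained n (suc j) m → m ≤ n * j + 6 * (j * j)
attained-≤ {j = j} _ (G , (c , proper , ¬M) , refl) = numEdges-≤ j G c proper ¬M

-- The lower-bound construction.

module _ (n j : ℕ) where

  Covered : Fin n → Fin n → Set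
  Covered u v = u ≢ v × (toℕ u < j ⊎ toℕ v < j)

  covered? : ∀ u v → Dec (Covered u v)
  covered? u v = ¬? (u ≟ v) ×-dec ((toℕ u ℕ.<? j) ⊎-dec (toℕ v ℕ.<? j))

  join : Graph n
  join = graphOf covered? (λ (u≢v , cov) → ≢-sym u≢v , swap cov) (λ (v≢v , _) → v≢v refl)

  -- There are no `j + 1` disjoint edges, so any proper colouring serves; sums of indices are proper
  -- by cancellation.
  joinColouring : EdgeColouring join
  joinColouring = record { col = λ u v → toℕ u + toℕ v ; colSym = λ u v _ → ℕ.+-comm (toℕ u) _ }

  joinColouring-proper : Proper joinColouring
  joinColouring-proper u v w v≢w _ _ eq = v≢w (toℕ-injective (ℕ.+-cancelˡ-≡ (toℕ u) _ _ eq))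

  -- Pigeonhole: each of `j + 1` disjoint edges would need its own endpoint among the first `j`
  -- vertices.
  join-¬rainbow : ¬ RainbowMatching joinColouring (suc j)
  join-¬rainbow M = ℕ.1+n≰n (injective⇒≤ {f = λ i → fromℕ< (proj₂ (proj₂ (hit i)))} λ {i} {i′} eq →
    decidable-stable (i ≟ i′) λ i≢i′ → separate i≢i′ (proj₁ (proj₂ (hit i))) (proj₁ (proj₂ (hit i′)))
      (toℕ-injective (Fin.fromℕ<-injective _ _ _ _ eq)))
    where
    hit : ∀ i → ∃ λ w → Endpoint w (edge M i) × toℕ w < j
    hit i with does⁻ (covered? _ _) (isEdge M i)
    ... | _ , inj₁ a<j = _ , inj₁ refl , a<j
    ... | _ , inj₂ b<j = _ , inj₂ refl , b<j

    separate : ∀ {i i′ w w′} → i ≢ i′ → Endpoint w (edge M i) → Endpoint w′ (edge M i′) → w ≢ w′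
    separate i≢ (inj₁ refl) (inj₁ refl) = disj₁₁ M _ _ i≢
    separate i≢ (inj₁ refl) (inj₂ refl) = disj₁₂ M _ _ i≢
    -- `disj₁₂` compares a first endpoint with a second one, so the indices are exchanged.
    separate i≢ (inj₂ refl) (inj₁ refl) = disj₁₂ M _ _ (≢-sym i≢) ∘ sym
    separate i≢ (inj₂ refl) (inj₂ refl) = disj₂₂ M _ _ i≢

  join-admissible : Admissible join (suc j)
  join-admissible = joinColouring , joinColouring-proper , join-¬rainbow

numEdges-join-≥ : ∀ j r → j * r ≤ numEdges (join (j + r) j)
numEdges-join-≥ j r = ≤-trans (≤-reflexive (sym size)) (length-mono-⊆ unique included)
  where
  place : Fin j × Fin r → Fin (j + r) × Fin (j + r)
  place (u , v) = u ↑ˡ r , j ↑ʳ v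

  crossing : List (Fin (j + r) × Fin (j + r))
  crossing = map place (cartesianProduct (allFin j) (allFin r))

  size : length crossing ≡ j * r
  size = trans (length-map place (cartesianProduct (allFin j) (allFin r)))
    (trans (length-cartesianProduct (allFin j) (allFin r)) (cong₂ _*_ (length-allFin j) (length-allFin r)))

  unique : Unique crossing
  unique = map⁺ (λ eq → let p , q = ,-injective eq in cong₂ _,_ (↑ˡ-injective r _ _ p) (↑ʳ-injective j _ _ q))
                (cartesianProduct⁺ (allFin⁺ j) (allFin⁺ r))

  included : crossing ⊆ edges (join (j + r) j)
  included e∈ with (u , v) , _ , refl ← ∈-map⁻ place e∈ = ∈-edges⁺ (join (j + r) j) u<v
    (dec-true (covered? (j + r) j _ _) ((λ u≡v → ℕ.<⇒≢ u<v (cong toℕ u≡v)) , inj₁ u<j))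
    where
    u<j : toℕ (u ↑ˡ r) < j
    u<j = subst (_< j) (sym (toℕ-↑ˡ u r)) (toℕ<n u)

    u<v : toℕ (u ↑ˡ r) < toℕ (j ↑ʳ v)
    u<v = ℕ.<-≤-trans u<j (≤-trans (ℕ.m≤m+n j (toℕ v)) (≤-reflexive (sym (toℕ-↑ʳ j v))))

-- Counting only the edges that leave the first `j` vertices gives `j * r` with `n = j + r`, and
-- `j * j` makes up the difference. For `n ≤ j` the error term alone suffices.
n*j≤numEdges-join : ∀ n j → n * j ≤ numEdges (join n j) + j * j
n*j≤numEdges-join n j with ℕ.≤-total n j
... | inj₁ n≤j = ≤-trans (ℕ.*-monoˡ-≤ j n≤j) (ℕ.m≤n+m _ _)
... | inj₂ j≤n with r , refl ← ℕ.m≤n⇒∃[o]m+o≡n j≤n = begin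
  (j + r) * j                        ≡⟨ solve 2 (λ j r → (j :+ r) :* j := j :* r :+ j :* j) refl j r ⟩
  j * r + j * j                      ≤⟨ ℕ.+-monoˡ-≤ (j * j) (numEdges-join-≥ j r) ⟩
  numEdges (join (j + r) j) + j * j  ∎
  where open ℕ.≤-Reasoning ; open +-*-Solver

theorem1 : Σ ℕ λ C → ∀ (n k : ℕ) → 1 ≤ k →
    Σ ℕ λ m → IsRainbowTuranMatching n k m ×
    (m ≤ n * (k ∸ 1) + C * (k * k)) × (n * (k ∸ 1) ≤ m + C * (k * k))
-- The 6 comes from the upper bound; the lower bound has error only `j * j`, where `k = suc j`.
theorem1 = 6 , λ where
  n (suc j) _ →
    -- The upper bound also limits the search for the maximum, and `join` supplies an attained
    -- value.
    let m , attained , greatest = maximum (attained? n (suc j)) (n * j + 6 * (j * j)) attained-≤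
          (_ , join n j , join-admissible n j , refl)
        j²≤k² = ℕ.*-mono-≤ (ℕ.n≤1+n j) (ℕ.n≤1+n j)
    in m , (attained , λ G adm → greatest (numEdges G) (G , adm , refl))
     , ≤-trans (attained-≤ m attained) (ℕ.+-monoʳ-≤ (n * j) (ℕ.*-monoʳ-≤ 6 j²≤k²))
     , ≤-trans (n*j≤numEdges-join n j) (ℕ.+-mono-≤ (greatest _ (join n j , join-admissible n j , refl))
         (≤-trans j²≤k² (ℕ.m≤m+n _ _)))
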